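{- There exist (finite, simple) bipartite graphs $G$ for which the independent set sequence $i(G) = (i_t(G))_{t=0}^{\alpha(G)}$ is not unimodal.
   Context: For a graph $G=(V,E)$, an independent set is a set of vertices spanning no edges. For an integer $t \geq 0$, $i_t(G)$ denotes the number of independent sets of size $t$ in $G$, and $\alpha(G)$ denotes the size of a largest independent set in $G$. The independent set sequence of $G$ is $i(G) = (i_t(G))_{t=0}^{\alpha(G)}$. It is unimodal if there is a $k$ (with $0 \leq k \leq \alpha(G)$) for which $i_0(G) \leq i_1(G) \leq \cdots \leq i_k(G) \geq i_{k+1}(G) \geq \cdots \geq i_{\alpha(G)}(G)$. -}

module Defs where

open import Data.Bool using (true; false)
open import Data.Fin using (Fin)
open import Data.Fin.Properties using (all?)
open import Data.Fin.Subset using (Subset; inside; outside; _∈_; ∁; ∣_∣)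
open import Data.Fin.Subset.Properties using (_∈?_)
open import Data.List using (List; []; _∷_; _++_; map; filter; length)
open import Data.List.Extrema.Nat using (max)
import Data.List.Membership.Propositional as List
open import Data.List.Membership.Propositional.Properties
  using (∈-map⁺; ∈-map⁻; ∈-++⁺ˡ; ∈-++⁺ʳ)
open import Data.List.Relation.Unary.All using ([])
open import Data.List.Relation.Unary.Any using (here)
open import Data.List.Relation.Unary.AllPairs using ([]; _∷_)
open import Data.List.Relation.Unary.Unique.Propositional using (Unique)
open import Data.List.Relation.Unary.Unique.Propositional.Properties
  using (map⁺; ++⁺)
open import Data.Nat using (ℕ; zero; suc; _≤_; _≥_; _<_; _≟_)
open import Data.Product using (∃-syntax; _×_; _,_)
import Data.Vec as Vec
open import Data.Vec.Properties using (∷-injectiveʳ)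
open import Level using (0ℓ)
open import Relation.Binary using (Rel; Decidable; Symmetric; Irreflexive)
open import Relation.Binary.PropositionalEquality using (_≡_; refl)
open import Relation.Nullary using (¬_; Dec)
open import Relation.Nullary.Decidable using (¬?; _→-dec_)

-- Adjacency is required to be decidable so that independent sets can be counted.
record Graph (n : ℕ) : Set₁ where
  field
    Adj    : Rel (Fin n) 0ℓ
    adj?   : Decidable Adj
    symm   : Symmetric Adj
    irrefl : Irreflexive _≡_ Adj

Independent : ∀ {n} → Graph n → Subset n → Set
Independent G S = ∀ u v → u ∈ S → v ∈ S → ¬ Graph.Adj G u v

Bipartite : ∀ {n} → Graph n → Set
Bipartite G = ∃[ X ] Independent G X × Independent G (∁ X)

independent? : ∀ {n} (G : Graph n) (S : Subset n) → Dec (Independent G S)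
independent? G S = all? λ u → all? λ v →
  (u ∈? S) →-dec (v ∈? S) →-dec ¬? (Graph.adj? G u v)

subsets : ∀ n → List (Subset n)
subsets zero    = Vec.[] ∷ []
subsets (suc n) = map (outside Vec.∷_) (subsets n) ++ map (inside Vec.∷_) (subsets n)

-- Each subset is listed exactly once, so lengths of filtered lists are
-- cardinalities.
subsets-complete : ∀ {n} (S : Subset n) → S List.∈ subsets n
subsets-complete Vec.[]            = here refl
subsets-complete (false Vec.∷ S)   = ∈-++⁺ˡ (∈-map⁺ (outside Vec.∷_) (subsets-complete S))
subsets-complete {suc n} (true Vec.∷ S) =
  ∈-++⁺ʳ (map (outside Vec.∷_) (subsets n)) (∈-map⁺ (inside Vec.∷_) (subsets-complete S))

subsets-unique : ∀ n → Unique (subsets n)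
subsets-unique zero    = [] ∷ []
subsets-unique (suc n) =
  ++⁺ (map⁺ ∷-injectiveʳ (subsets-unique n)) (map⁺ ∷-injectiveʳ (subsets-unique n)) disjoint
  where
  disjoint : ∀ {S} → ¬ (S List.∈ map (outside Vec.∷_) (subsets n) ×
                        S List.∈ map (inside Vec.∷_) (subsets n))
  disjoint (p , q) with ∈-map⁻ (outside Vec.∷_) p | ∈-map⁻ (inside Vec.∷_) q
  ... | _ , _ , refl | _ , _ , ()

independentSets : ∀ {n} → Graph n → List (Subset n)
independentSets {n} G = filter (independent? G) (subsets n)

i : ∀ {n} → ℕ → Graph n → ℕ
i t G = length (filter (λ S → ∣ S ∣ ≟ t) (independentSets G))

-- The default value 0 is the size of the empty set, which is always independent.
α : ∀ {n} → Graph n → ℕ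
α G = max 0 (map ∣_∣ (independentSets G))

-- Unimodality of the finite sequence f 0, …, f m.
Unimodal : (m : ℕ) → (ℕ → ℕ) → Set
Unimodal m f = ∃[ k ] k ≤ m
  × (∀ t → t < k → f t ≤ f (suc t))
  × (∀ t → k ≤ t → t < m → f t ≥ f (suc t))

{-# OPTIONS --safe #-}
-- Take disjoint sets A, B, D of sizes a, a, c, put a perfect matching between A and B and
-- join every vertex of A to every vertex of D.  An independent set missing A is any subset
-- of B ∪ D; one meeting A misses D and uses each matching edge at most once.  Hence
-- i_t = C(a+c, t) + (2^t − 1) C(a, t).  The first term peaks at t ≈ (a+c)/2 and the second at
-- t ≈ 2a/3, and for a = 79, c = 47 both peaks have comparable height and are visible in the sum.
module Submission where

open import Defs
open import Data.Bool using (Bool; true; false; if_then_else_; _∧_)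
open import Data.Empty using (⊥-elim) renaming (⊥ to Absurd)
open import Data.Fin using (Fin; zero; suc; splitAt; _↑ˡ_; _↑ʳ_)
open import Data.Fin.Properties using (splitAt-↑ˡ; splitAt-↑ʳ)
open import Data.Fin.Subset
  using (Subset; Nonempty; inside; outside; _∈_; _⊆_; ∁; ⊤; ⊥; ⁅_⁆; ∣_∣)
open import Data.Fin.Subset.Properties
  using (_∈?_; _⊆?_; nonempty?; ∈⊤; ∉⊥; ∣⊤∣≡n; ∣⊥∣≡0; x∈⁅x⁆; x∈⁅y⁆⇒x≡y
        ; x∉p⇒x∈∁p; x∈∁p⇒x∉p; out⊆-⇔; in⊆in-⇔)
import Data.List as List
open import Data.List using (List)
import Data.List.Membership.Propositional as List
open import Data.List.Extrema.Nat using (xs≤max)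
open import Data.List.Membership.Propositional.Properties using (∈-map⁺; ∈-filter⁻)
open import Data.List.Properties using (map-++; map-∘)
open import Data.List.Relation.Unary.All using (lookup)
open import Data.List.Relation.Unary.Any using (here)
open import Data.Nat using (ℕ; zero; suc; _+_; _*_; _∸_; _^_; _≤_; _<_; z≤n; _≟_; _<?_)
open import Data.Nat.Combinatorics using (_C_; nCk+nC[k+1]≡[n+1]C[k+1])
open import Data.Nat.ListAction using (sum)
open import Data.Nat.ListAction.Properties using (sum-++)
open import Data.Nat.Properties
  using (+-comm; +-identityʳ; +-suc; *-zeroʳ; m+n∸n≡m; ≤-trans; ≤-<-trans; <⇒≱; ≮⇒≥; <ᵇ⇒<; ≤ᵇ⇒≤)
open import Data.Nat.Solver using (module +-*-Solver)
open import Data.Product using (Σ; ∃-syntax; _×_; _,_; proj₁; proj₂)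
open import Data.Sum as Sum using (_⊎_; inj₁; inj₂; [_,_]′)
open import Data.Vec using ([]; _∷_; _++_; replicate; here; there)
import Data.Vec.Properties as Vec
open import Function using (_∘_; id; _⇔_; mk⇔; Equivalence)
open import Function.Construct.Symmetry using (⇔-sym)
open import Level using (0ℓ)
open import Relation.Binary.PropositionalEquality
  using (_≡_; _≗_; refl; sym; trans; cong; cong₂; subst; subst₂; module ≡-Reasoning)
open import Relation.Nullary using (¬_; Dec; yes; no; does)
open import Relation.Nullary.Decidable using (dec-true; dec-false; does-⇔)
open import Relation.Unary using (Pred; Decidable)

open +-*-Solver using (solve; _:+_; _:*_; _:=_; con)

-- Sums over all subsets of a finite set.

𝟙 : Bool → ℕ
𝟙 b = if b then 1 else 0

-- Recursion on the first coordinate, rather than a sum over the list `subsets n`, lets inductions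
-- on `n` and splittings along `_++_` go through by unfolding.
∑ : ∀ {n} → (Subset n → ℕ) → ℕ
∑ {zero}  f = f []
∑ {suc n} f = ∑ (λ S → f (outside ∷ S)) + ∑ (λ S → f (inside ∷ S))

∑-cong : ∀ {n} {f g : Subset n → ℕ} → f ≗ g → ∑ f ≡ ∑ g
∑-cong {zero}  f≗g = f≗g []
∑-cong {suc n} f≗g = cong₂ _+_ (∑-cong (f≗g ∘ (outside ∷_))) (∑-cong (f≗g ∘ (inside ∷_)))

∑-zero : ∀ n → ∑ {n} (λ _ → 0) ≡ 0
∑-zero zero    = refl
∑-zero (suc n) = cong₂ _+_ (∑-zero n) (∑-zero n)

∑-distrib-+ : ∀ {n} (f g : Subset n → ℕ) → ∑ (λ S → f S + g S) ≡ ∑ f + ∑ g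
∑-distrib-+ {zero}  f g = refl
∑-distrib-+ {suc n} f g = trans
  (cong₂ _+_ (∑-distrib-+ (f ∘ (outside ∷_)) (g ∘ (outside ∷_)))
             (∑-distrib-+ (f ∘ (inside ∷_)) (g ∘ (inside ∷_))))
  (solve 4 (λ x y z w → (x :+ y) :+ (z :+ w) := (x :+ z) :+ (y :+ w)) refl
    (∑ (f ∘ (outside ∷_))) (∑ (g ∘ (outside ∷_))) (∑ (f ∘ (inside ∷_))) (∑ (g ∘ (inside ∷_))))

∑-++ : ∀ a {b} (f : Subset (a + b) → ℕ) → ∑ f ≡ ∑ {a} (λ S → ∑ (λ T → f (S ++ T)))
∑-++ zero    f = refl
∑-++ (suc a) f = cong₂ _+_ (∑-++ a (f ∘ (outside ∷_))) (∑-++ a (f ∘ (inside ∷_)))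

-- Allows a summand to be replaced when it differs only at the empty set. The exceptional terms are
-- added on opposite sides to avoid truncated subtraction. In the induction `⊥` lies in the
-- `outside` half, so the `inside` halves agree term by term.
∑-agree-off-⊥ : ∀ {n} {f g : Subset n → ℕ} → (∀ S → Nonempty S → f S ≡ g S) →
                ∑ f + g ⊥ ≡ ∑ g + f ⊥
∑-agree-off-⊥ {zero}  {f} {g} f≡g = +-comm (f []) (g [])
∑-agree-off-⊥ {suc n} {f} {g} f≡g = begin
  (∑ f₀ + ∑ f₁) + g₀ ⊥  ≡⟨ swap (∑ f₀) (∑ f₁) (g₀ ⊥) ⟩
  (∑ f₀ + g₀ ⊥) + ∑ f₁  ≡⟨ cong₂ _+_ (∑-agree-off-⊥ (λ { S (x , x∈S) → f≡g (outside ∷ S) (suc x , there x∈S) }))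
                                     (∑-cong (λ S → f≡g (inside ∷ S) (zero , here))) ⟩
  (∑ g₀ + f₀ ⊥) + ∑ g₁  ≡⟨ swap (∑ g₀) (f₀ ⊥) (∑ g₁) ⟩
  (∑ g₀ + ∑ g₁) + f₀ ⊥  ∎
  where
  open ≡-Reasoning
  f₀ f₁ g₀ g₁ : Subset n → ℕ
  f₀ = f ∘ (outside ∷_)
  f₁ = f ∘ (inside ∷_)
  g₀ = g ∘ (outside ∷_)
  g₁ = g ∘ (inside ∷_)
  swap : ∀ x y z → (x + y) + z ≡ (x + z) + y
  swap = solve 3 (λ x y z → (x :+ y) :+ z := (x :+ z) :+ y) refl

sum-subsets : ∀ {n} (f : Subset n → ℕ) → sum (List.map f (subsets n)) ≡ ∑ f
sum-subsets {zero}  f = +-identityʳ (f [])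
sum-subsets {suc n} f = begin
  sum (List.map f (outs List.++ ins))               ≡⟨ cong sum (map-++ f outs ins) ⟩
  sum (List.map f outs List.++ List.map f ins)      ≡⟨ sum-++ (List.map f outs) (List.map f ins) ⟩
  sum (List.map f outs) + sum (List.map f ins)      ≡⟨ cong₂ _+_ (half outside) (half inside) ⟩
  ∑ f                                               ∎
  where
  open ≡-Reasoning
  outs ins : List (Subset (suc n))
  outs = List.map (outside ∷_) (subsets n)
  ins  = List.map (inside ∷_) (subsets n)
  half : ∀ s → sum (List.map f (List.map (s ∷_) (subsets n))) ≡ ∑ (f ∘ (s ∷_))
  half s = trans (cong sum (sym (map-∘ (subsets n)))) (sum-subsets (f ∘ (s ∷_)))

length-filter-filter : ∀ {A : Set} {P Q : Pred A 0ℓ} (P? : Decidable P) (Q? : Decidable Q) xs →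
  List.length (List.filter Q? (List.filter P? xs)) ≡
  sum (List.map (λ x → 𝟙 (does (P? x) ∧ does (Q? x))) xs)
length-filter-filter P? Q? List.[] = refl
length-filter-filter P? Q? (x List.∷ xs) with does (P? x)
... | false = length-filter-filter P? Q? xs
... | true with does (Q? x)
...   | false = length-filter-filter P? Q? xs
...   | true  = cong suc (length-filter-filter P? Q? xs)

i-as-∑ : ∀ {n} t (G : Graph n) →
         i t G ≡ ∑ (λ S → 𝟙 (does (independent? G S) ∧ does (∣ S ∣ ≟ t)))
i-as-∑ {n} t G = trans
  (length-filter-filter (independent? G) (λ S → ∣ S ∣ ≟ t) (subsets n))
  (sum-subsets (λ S → 𝟙 (does (independent? G S) ∧ does (∣ S ∣ ≟ t))))

-- Binomial counts of subsets.

-- m C (t ∸ s), except that it vanishes when t < s.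
binom : (m s t : ℕ) → ℕ
binom m zero    t       = m C t
binom m (suc s) zero    = 0
binom m (suc s) (suc t) = binom m s t

binom-pascal : ∀ m s t → binom m s t + binom m (suc s) t ≡ binom (suc m) s t
binom-pascal m zero    zero    = refl
binom-pascal m zero    (suc t) = trans (+-comm (m C suc t) (m C t)) (nCk+nC[k+1]≡[n+1]C[k+1] m t)
binom-pascal m (suc s) zero    = refl
binom-pascal m (suc s) (suc t) = binom-pascal m s t

binom-zero : ∀ s t → 𝟙 (does (s + 0 ≟ t)) ≡ binom 0 s t
binom-zero zero    zero    = refl
binom-zero zero    (suc t) = refl
binom-zero (suc s) zero    = refl
binom-zero (suc s) (suc t) = binom-zero s t

-- The offset `s` stands for elements chosen beforehand. It has to vary in the induction: putting an
-- element of `U` into `T` raises it by one, and the two choices add up by Pascal's rule.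
count-subsets-of : ∀ {n} (U : Subset n) s t →
  ∑ (λ T → 𝟙 (does (T ⊆? U) ∧ does (s + ∣ T ∣ ≟ t))) ≡ binom ∣ U ∣ s t
count-subsets-of [] s t
  rewrite dec-true ([] ⊆? []) id = binom-zero s t
count-subsets-of {suc n} (outside ∷ U) s t = begin
  ∑ (λ T → 𝟙 (does ((outside ∷ T) ⊆? (outside ∷ U)) ∧ does (s + ∣ T ∣ ≟ t))) +
  ∑ (λ T → 𝟙 (does ((inside ∷ T) ⊆? (outside ∷ U)) ∧ does (s + suc ∣ T ∣ ≟ t)))
    ≡⟨ cong₂ _+_
         (∑-cong λ T → cong (λ b → 𝟙 (b ∧ does (s + ∣ T ∣ ≟ t)))
           (does-⇔ (⇔-sym out⊆-⇔) ((outside ∷ T) ⊆? (outside ∷ U)) (T ⊆? U)))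
         (∑-cong λ T → cong (λ b → 𝟙 (b ∧ does (s + suc ∣ T ∣ ≟ t)))
           (dec-false ((inside ∷ T) ⊆? (outside ∷ U)) (in⊈out T))) ⟩
  ∑ (λ T → 𝟙 (does (T ⊆? U) ∧ does (s + ∣ T ∣ ≟ t))) + ∑ {n} (λ _ → 0)
    ≡⟨ cong₂ _+_ (count-subsets-of U s t) (∑-zero n) ⟩
  (binom ∣ U ∣ s t) + 0
    ≡⟨ +-identityʳ _ ⟩
  (binom ∣ U ∣ s t) ∎
  where
  open ≡-Reasoning
  in⊈out : ∀ T → ¬ ((inside ∷ T) ⊆ (outside ∷ U))
  in⊈out T T⊆U with () ← T⊆U here
count-subsets-of (inside ∷ U) s t = begin
  ∑ (λ T → 𝟙 (does ((outside ∷ T) ⊆? (inside ∷ U)) ∧ does (s + ∣ T ∣ ≟ t))) +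
  ∑ (λ T → 𝟙 (does ((inside ∷ T) ⊆? (inside ∷ U)) ∧ does (s + suc ∣ T ∣ ≟ t)))
    ≡⟨ cong₂ _+_
         (∑-cong λ T → cong (λ b → 𝟙 (b ∧ does (s + ∣ T ∣ ≟ t)))
           (does-⇔ (⇔-sym out⊆-⇔) ((outside ∷ T) ⊆? (inside ∷ U)) (T ⊆? U)))
         (∑-cong λ T → cong₂ (λ b m → 𝟙 (b ∧ does (m ≟ t)))
           (does-⇔ (⇔-sym in⊆in-⇔) ((inside ∷ T) ⊆? (inside ∷ U)) (T ⊆? U))
           (+-suc s ∣ T ∣)) ⟩
  ∑ (λ T → 𝟙 (does (T ⊆? U) ∧ does (s + ∣ T ∣ ≟ t))) +
  ∑ (λ T → 𝟙 (does (T ⊆? U) ∧ does (suc s + ∣ T ∣ ≟ t)))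
    ≡⟨ cong₂ _+_ (count-subsets-of U s t) (count-subsets-of U (suc s) t) ⟩
  (binom ∣ U ∣ s t) + (binom ∣ U ∣ (suc s) t)
    ≡⟨ binom-pascal ∣ U ∣ s t ⟩
  (binom (suc ∣ U ∣) s t) ∎
  where open ≡-Reasoning

-- The left side counts the t-element partial transversals of the a disjoint pairs {x, x′}.
∑-binom : ∀ a t → ∑ {a} (λ S → binom ∣ ∁ S ∣ ∣ S ∣ t) ≡ 2 ^ t * (a C t)
∑-binom zero    zero    = refl
∑-binom zero    (suc t) = sym (*-zeroʳ (2 ^ suc t))
∑-binom (suc a) t = begin
  ∑ {a} (λ S → binom (suc ∣ ∁ S ∣) ∣ S ∣ t) + ∑ (B t)
    ≡⟨ cong (_+ ∑ (B t)) (∑-cong {a} λ S → sym (binom-pascal ∣ ∁ S ∣ ∣ S ∣ t)) ⟩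
  ∑ {a} (λ S → binom ∣ ∁ S ∣ ∣ S ∣ t + B t S) + ∑ (B t)
    ≡⟨ cong (_+ ∑ (B t)) (∑-distrib-+ (λ S → binom ∣ ∁ S ∣ ∣ S ∣ t) (B t)) ⟩
  (∑ {a} (λ S → binom ∣ ∁ S ∣ ∣ S ∣ t) + ∑ (B t)) + ∑ (B t)
    ≡⟨ cong (λ x → (x + ∑ (B t)) + ∑ (B t)) (∑-binom a t) ⟩
  (2 ^ t * (a C t) + ∑ (B t)) + ∑ (B t)
    ≡⟨ step t ⟩
  2 ^ t * (suc a C t) ∎
  where
  open ≡-Reasoning
  B : ℕ → Subset a → ℕ
  B t′ S = binom ∣ ∁ S ∣ (suc ∣ S ∣) t′
  -- At `t′ = 0` every term of `B` vanishes, since its offset is positive. At a successor,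
  -- `B (suc t′)` unfolds to the original summand at `t′`, so the induction hypothesis applies a
  -- second time.
  step : ∀ t′ → (2 ^ t′ * (a C t′) + ∑ (B t′)) + ∑ (B t′) ≡ 2 ^ t′ * (suc a C t′)
  step zero     = cong (λ x → (1 + x) + x) (∑-zero a)
  step (suc t′) = begin
    (2 * 2 ^ t′ * (a C suc t′) + ∑ (B (suc t′))) + ∑ (B (suc t′))
      ≡⟨ cong (λ x → (2 * 2 ^ t′ * (a C suc t′) + x) + x) (∑-binom a t′) ⟩
    (2 * 2 ^ t′ * (a C suc t′) + 2 ^ t′ * (a C t′)) + 2 ^ t′ * (a C t′)
      ≡⟨ solve 3 (λ p x y → (con 2 :* p :* x :+ p :* y) :+ p :* y := con 2 :* p :* (y :+ x))
           refl (2 ^ t′) (a C suc t′) (a C t′) ⟩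
    2 * 2 ^ t′ * (a C t′ + a C suc t′)
      ≡⟨ cong (2 * 2 ^ t′ *_) (nCk+nC[k+1]≡[n+1]C[k+1] a t′) ⟩
    2 * 2 ^ t′ * (suc a C suc t′) ∎

-- Subsets of a disjoint union.

∣++∣ : ∀ {a b} (S : Subset a) (T : Subset b) → ∣ S ++ T ∣ ≡ ∣ S ∣ + ∣ T ∣
∣++∣ []            T = refl
∣++∣ (outside ∷ S) T = ∣++∣ S T
∣++∣ (inside  ∷ S) T = cong suc (∣++∣ S T)

∁-++ : ∀ {a b} (S : Subset a) (T : Subset b) → ∁ (S ++ T) ≡ ∁ S ++ ∁ T
∁-++ S T = Vec.map-++ _ S T

∁⊤≡⊥ : ∀ n → ∁ (⊤ {n}) ≡ ⊥
∁⊤≡⊥ n = Vec.map-replicate _ inside n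

∁⊥≡⊤ : ∀ n → ∁ (⊥ {n}) ≡ ⊤
∁⊥≡⊤ n = Vec.map-replicate _ outside n

-- Membership is expressed through `splitAt` because adjacency in the graphs below is defined by the
-- same case split.
∈-++⁻ : ∀ {a b} (S : Subset a) {T : Subset b} {u} → u ∈ S ++ T →
        [ _∈ S , _∈ T ]′ (splitAt a u)
∈-++⁻ []      u∈T = u∈T
∈-++⁻ (_ ∷ S) here = here
∈-++⁻ {suc a} (_ ∷ S) {u = suc u} (there u∈) with splitAt a u | ∈-++⁻ S u∈
... | inj₁ _ | p = there p
... | inj₂ _ | p = p

∈-++⁺ : ∀ {a b} (S : Subset a) {T : Subset b} {u} →
        [ _∈ S , _∈ T ]′ (splitAt a u) → u ∈ S ++ T
∈-++⁺ []      u∈T = u∈T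
∈-++⁺ (_ ∷ S) {u = zero} here = here
∈-++⁺ {suc a} (s ∷ S) {T} {suc u} p = there (∈-++⁺ S (drop (splitAt a u) p))
  where
  drop : ∀ q → [ _∈ s ∷ S , _∈ T ]′ (Sum.map suc id q) → [ _∈ S , _∈ T ]′ q
  drop (inj₁ _) (there x∈S) = x∈S
  drop (inj₂ _) y∈T         = y∈T

-- Bipartite graphs given by the neighbourhoods of the left vertices.

module _ {a b} (N : Fin a → Subset b) where

  Edge : Fin a ⊎ Fin b → Fin a ⊎ Fin b → Set
  Edge (inj₁ x) (inj₂ y) = y ∈ N x
  Edge (inj₂ y) (inj₁ x) = y ∈ N x
  Edge (inj₁ _) (inj₁ _) = Absurd
  Edge (inj₂ _) (inj₂ _) = Absurd

  edge? : ∀ p q → Dec (Edge p q)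
  edge? (inj₁ x) (inj₂ y) = y ∈? N x
  edge? (inj₂ y) (inj₁ x) = y ∈? N x
  edge? (inj₁ _) (inj₁ _) = no λ ()
  edge? (inj₂ _) (inj₂ _) = no λ ()

  edge-sym : ∀ p q → Edge p q → Edge q p
  edge-sym (inj₁ x) (inj₂ y) e = e
  edge-sym (inj₂ y) (inj₁ x) e = e

  edge-irrefl : ∀ p → ¬ Edge p p
  edge-irrefl (inj₁ _) ()
  edge-irrefl (inj₂ _) ()

  bipartiteGraph : Graph (a + b)
  bipartiteGraph = record
    { Adj    = λ u v → Edge (splitAt a u) (splitAt a v)
    ; adj?   = λ u v → edge? (splitAt a u) (splitAt a v)
    ; symm   = λ {u} {v} → edge-sym (splitAt a u) (splitAt a v)
    ; irrefl = λ { {u} refl → edge-irrefl (splitAt a u) }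
    }

  -- Two vertices on the same side are never adjacent, so only the cross pairs impose a condition.
  independent-++ : ∀ (S : Subset a) (T : Subset b) →
    Independent bipartiteGraph (S ++ T) ⇔ (∀ x y → x ∈ S → y ∈ T → ¬ y ∈ N x)
  independent-++ S T = mk⇔ to from
    where
    to : Independent bipartiteGraph (S ++ T) → ∀ x y → x ∈ S → y ∈ T → ¬ y ∈ N x
    to ind x y x∈S y∈T y∈Nx = ind (x ↑ˡ b) (a ↑ʳ y)
      (∈-++⁺ S (subst [ _∈ S , _∈ T ]′ (sym (splitAt-↑ˡ a x b)) x∈S))
      (∈-++⁺ S (subst [ _∈ S , _∈ T ]′ (sym (splitAt-↑ʳ a b y)) y∈T))
      (subst₂ Edge (sym (splitAt-↑ˡ a x b)) (sym (splitAt-↑ʳ a b y)) y∈Nx)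
    from : (∀ x y → x ∈ S → y ∈ T → ¬ y ∈ N x) → Independent bipartiteGraph (S ++ T)
    from h u v u∈ v∈ e = go (splitAt a u) (splitAt a v) (∈-++⁻ S u∈) (∈-++⁻ S v∈) e
      where
      go : ∀ p q → [ _∈ S , _∈ T ]′ p → [ _∈ S , _∈ T ]′ q → ¬ Edge p q
      go (inj₁ x) (inj₂ y) x∈S y∈T = h x y x∈S y∈T
      go (inj₂ y) (inj₁ x) y∈T x∈S = h x y x∈S y∈T

  bipartiteGraph-bipartite : Bipartite bipartiteGraph
  -- The colour class is the whole left side. It has no right vertices and its complement has no
  -- left ones, so the cross-pair condition is vacuous for both.
  bipartiteGraph-bipartite = ⊤ {a} ++ ⊥
    , Equivalence.from (independent-++ ⊤ ⊥) (λ _ _ _ y∈⊥ → ⊥-elim (∉⊥ y∈⊥))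
    , subst (Independent bipartiteGraph) (sym (∁-++ (⊤ {a}) ⊥))
        (Equivalence.from (independent-++ (∁ ⊤) (∁ ⊥))
          (λ _ _ x∈∁⊤ → ⊥-elim (x∈∁p⇒x∉p x∈∁⊤ ∈⊤)))

-- The graph of the counterexample and its independent set counts.

module _ (a c : ℕ) where

  -- The first `a` right vertices form B and the last `c` form D: `⁅ x ⁆` is the matching edge at
  -- `x`, and `⊤` is all of D.
  nbrs : Fin a → Subset (a + c)
  nbrs x = ⁅ x ⁆ ++ ⊤

  G : Graph (a + (a + c))
  G = bipartiteGraph nbrs

  -- The union of `nbrs x` over `x` in `S`: the partners of `S`, together with all of D as soon as
  -- `S` is nonempty.
  nbrsOf : Subset a → Subset (a + c)
  nbrsOf S = S ++ replicate c (does (nonempty? S))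

  ∈-nbrsOf⁺ : ∀ S {x y} → x ∈ S → y ∈ nbrs x → y ∈ nbrsOf S
  ∈-nbrsOf⁺ S {x} {y} x∈S y∈ = ∈-++⁺ S (go (splitAt a y) (∈-++⁻ ⁅ x ⁆ y∈))
    where
    go : ∀ p → [ _∈ ⁅ x ⁆ , _∈ ⊤ ]′ p → [ _∈ S , _∈ replicate c (does (nonempty? S)) ]′ p
    go (inj₁ k) k∈⁅x⁆ = subst (_∈ S) (sym (x∈⁅y⁆⇒x≡y x k∈⁅x⁆)) x∈S
    go (inj₂ k) k∈⊤ rewrite dec-true (nonempty? S) (x , x∈S) = ∈⊤

  ∈-nbrsOf⁻ : ∀ S {y} → y ∈ nbrsOf S → ∃[ x ] x ∈ S × y ∈ nbrs x
  ∈-nbrsOf⁻ S {y} y∈ with splitAt a y in eq | ∈-++⁻ S y∈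
  ... | inj₁ k | k∈S =
    k , k∈S , ∈-++⁺ ⁅ k ⁆ (subst [ _∈ ⁅ k ⁆ , _∈ ⊤ ]′ (sym eq) (x∈⁅x⁆ k))
  ... | inj₂ k | k∈ with nonempty? S
  ...   | yes (x , x∈S) = x , x∈S , ∈-++⁺ ⁅ x ⁆ (subst [ _∈ ⁅ x ⁆ , _∈ ⊤ ]′ (sym eq) ∈⊤)
  ...   | no _          = ⊥-elim (∉⊥ k∈)

  -- For fixed `S` the admissible `T` are thus all subsets of one fixed set, which
  -- `count-subsets-of` counts with offset `∣ S ∣`.
  independent-G : ∀ S T → Independent G (S ++ T) ⇔ T ⊆ ∁ (nbrsOf S)
  independent-G S T = mk⇔
    (λ ind {y} y∈T → x∉p⇒x∈∁p λ y∈ → let x , x∈S , y∈Nx = ∈-nbrsOf⁻ S y∈ in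
      Equivalence.to (independent-++ nbrs S T) ind x y x∈S y∈T y∈Nx)
    (λ T⊆ → Equivalence.from (independent-++ nbrs S T)
      λ x y x∈S y∈T y∈Nx → x∈∁p⇒x∉p (T⊆ y∈T) (∈-nbrsOf⁺ S x∈S y∈Nx))

  ∣∁nbrsOf∣-nonempty : ∀ S → Nonempty S → ∣ ∁ (nbrsOf S) ∣ ≡ ∣ ∁ S ∣
  ∣∁nbrsOf∣-nonempty S ne rewrite dec-true (nonempty? S) ne = begin
    ∣ ∁ (S ++ ⊤ {c}) ∣       ≡⟨ cong ∣_∣ (∁-++ S ⊤) ⟩
    ∣ ∁ S ++ ∁ (⊤ {c}) ∣     ≡⟨ ∣++∣ (∁ S) (∁ ⊤) ⟩
    ∣ ∁ S ∣ + ∣ ∁ (⊤ {c}) ∣  ≡⟨ cong (λ U → ∣ ∁ S ∣ + ∣ U ∣) (∁⊤≡⊥ c) ⟩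
    ∣ ∁ S ∣ + ∣ ⊥ {c} ∣      ≡⟨ cong (∣ ∁ S ∣ +_) (∣⊥∣≡0 c) ⟩
    ∣ ∁ S ∣ + 0              ≡⟨ +-identityʳ _ ⟩
    ∣ ∁ S ∣                  ∎
    where open ≡-Reasoning

  ∣∁nbrsOf⊥∣ : ∣ ∁ (nbrsOf ⊥) ∣ ≡ a + c
  ∣∁nbrsOf⊥∣ rewrite dec-false (nonempty? (⊥ {a})) (λ (_ , x∈⊥) → ∉⊥ x∈⊥) = begin
    ∣ ∁ (⊥ {a} ++ ⊥ {c}) ∣         ≡⟨ cong ∣_∣ (∁-++ (⊥ {a}) (⊥ {c})) ⟩
    ∣ ∁ (⊥ {a}) ++ ∁ (⊥ {c}) ∣     ≡⟨ ∣++∣ (∁ (⊥ {a})) (∁ ⊥) ⟩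
    ∣ ∁ (⊥ {a}) ∣ + ∣ ∁ (⊥ {c}) ∣  ≡⟨ cong₂ _+_ (∣∁⊥∣ a) (∣∁⊥∣ c) ⟩
    a + c                          ∎
    where
    open ≡-Reasoning
    ∣∁⊥∣ : ∀ n → ∣ ∁ (⊥ {n}) ∣ ≡ n
    ∣∁⊥∣ n = trans (cong ∣_∣ (∁⊥≡⊤ n)) (∣⊤∣≡n n)

  i-G-∑ : ∀ t → i t G ≡ ∑ {a} (λ S → binom ∣ ∁ (nbrsOf S) ∣ ∣ S ∣ t)
  i-G-∑ t = begin
    i t G
      ≡⟨ i-as-∑ t G ⟩
    ∑ (λ U → 𝟙 (does (independent? G U) ∧ does (∣ U ∣ ≟ t)))
      ≡⟨ ∑-++ a (λ U → 𝟙 (does (independent? G U) ∧ does (∣ U ∣ ≟ t))) ⟩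
    ∑ {a} (λ S → ∑ (λ T → 𝟙 (does (independent? G (S ++ T)) ∧ does (∣ S ++ T ∣ ≟ t))))
      ≡⟨ ∑-cong {a} (λ S → ∑-cong (λ T → cong₂ (λ b m → 𝟙 (b ∧ does (m ≟ t)))
           (does-⇔ (independent-G S T) (independent? G (S ++ T)) (T ⊆? ∁ (nbrsOf S)))
           (∣++∣ S T))) ⟩
    ∑ {a} (λ S → ∑ (λ T → 𝟙 (does (T ⊆? ∁ (nbrsOf S)) ∧ does (∣ S ∣ + ∣ T ∣ ≟ t))))
      ≡⟨ ∑-cong {a} (λ S → count-subsets-of (∁ (nbrsOf S)) ∣ S ∣ t) ⟩
    ∑ {a} (λ S → binom ∣ ∁ (nbrsOf S) ∣ ∣ S ∣ t) ∎
    where open ≡-Reasoning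

  -- The sum for `i t G` and the transversal sum of `∑-binom` agree except at `S = ⊥`, where D
  -- remains available: the former has the term `(a + c) C t`, the latter `a C t`.
  i-G+aCt : ∀ t → i t G + a C t ≡ 2 ^ t * (a C t) + (a + c) C t
  i-G+aCt t = begin
    i t G + a C t
      ≡⟨ cong₂ _+_ (i-G-∑ t) (sym (cong₂ (λ m s → binom m s t)
           (trans (cong ∣_∣ (∁⊥≡⊤ a)) (∣⊤∣≡n a)) (∣⊥∣≡0 a))) ⟩
    ∑ {a} (λ S → binom ∣ ∁ (nbrsOf S) ∣ ∣ S ∣ t) + (binom ∣ ∁ (⊥ {a}) ∣ ∣ ⊥ {a} ∣ t)
      ≡⟨ ∑-agree-off-⊥ (λ S ne → cong (λ m → binom m ∣ S ∣ t) (∣∁nbrsOf∣-nonempty S ne)) ⟩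
    ∑ {a} (λ S → binom ∣ ∁ S ∣ ∣ S ∣ t) + (binom ∣ ∁ (nbrsOf ⊥) ∣ ∣ ⊥ {a} ∣ t)
      ≡⟨ cong₂ _+_ (∑-binom a t) (cong₂ (λ m s → binom m s t) ∣∁nbrsOf⊥∣ (∣⊥∣≡0 a)) ⟩
    2 ^ t * (a C t) + (a + c) C t ∎
    where open ≡-Reasoning

  -- A closed form that can be evaluated without enumerating subsets. The truncated subtraction is
  -- exact by `i-G+aCt`.
  formula : ℕ → ℕ
  formula t = (2 ^ t * (a C t) + (a + c) C t) ∸ a C t

  i-G : ∀ t → i t G ≡ formula t
  i-G t = trans (sym (m+n∸n≡m (i t G) (a C t))) (cong (_∸ a C t) (i-G+aCt t))

-- A valley in the sequence rules out unimodality.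

0<i⇒t≤α : ∀ {n} t (G : Graph n) → 0 < i t G → t ≤ α G
0<i⇒t≤α {n} t G 0<i with List.filter (λ S → ∣ S ∣ ≟ t) (independentSets G) in eq
... | S List.∷ _ = subst (_≤ α G) ∣S∣≡t (lookup (xs≤max 0 _) (∈-map⁺ ∣_∣ S∈))
  where
  S∈×∣S∣≡t = ∈-filter⁻ (λ S → ∣ S ∣ ≟ t) {xs = independentSets G}
               (subst (S List.∈_) (sym eq) (here refl))
  S∈ = proj₁ S∈×∣S∣≡t
  ∣S∣≡t = proj₂ S∈×∣S∣≡t

-- A mode `k` beyond `t` would contradict the fall at `t`; otherwise `k ≤ t ≤ u`, and the rise at
-- `u` contradicts the descent after `k`.
valley⇒¬unimodal : ∀ {m f} t u → f (suc t) < f t → t ≤ u → u < m → f u < f (suc u) →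
                   ¬ Unimodal m f
valley⇒¬unimodal t u fall t≤u u<m rise (k , _ , up , down) with t <? k
... | yes t<k = <⇒≱ fall (up t t<k)
... | no  t≮k = <⇒≱ rise (down u (≤-trans (≮⇒≥ t≮k) t≤u) u<m)

formula-valley⇒¬unimodal : ∀ a c t u →
  formula a c (suc t) < formula a c t → t ≤ u → formula a c u < formula a c (suc u) →
  ¬ Unimodal (α (G a c)) (λ s → i s (G a c))
formula-valley⇒¬unimodal a c t u fall t≤u rise =
  valley⇒¬unimodal t u (transfer fall) t≤u
    -- The count at `suc u` is positive because it exceeds another natural number. Hence `suc u` is
    -- at most `α`, and the rise lies inside the sequence.
    (0<i⇒t≤α (suc u) (G a c) (≤-<-trans z≤n rise′)) rise′
  where
  transfer : ∀ {p q} → formula a c p < formula a c q → i p (G a c) < i q (G a c)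
  transfer {p} {q} = subst₂ _<_ (sym (i-G a c p)) (sym (i-G a c q))
  rise′ = transfer rise

theorem1p1 : Σ ℕ λ n → Σ (Graph n) λ G → Bipartite G × ¬ Unimodal (α G) (λ t → i t G)
theorem1p1 = _ , G 79 47 , bipartiteGraph-bipartite (nbrs 79 47)
  -- The indices lie between the peaks of the two terms, near 2 · 79 / 3 ≈ 53 and (79 + 47) / 2 =
  -- 63. The sequence falls from 56 to 57 and rises from 58 to 59; both inequalities are checked by
  -- evaluating `formula`.
  , formula-valley⇒¬unimodal 79 47 56 58
      (<ᵇ⇒< (formula 79 47 57) (formula 79 47 56) _)
      (≤ᵇ⇒≤ 56 58 _)
      (<ᵇ⇒< (formula 79 47 58) (formula 79 47 59) _)
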